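{- Let $G(V,E)$ be an eulerian graph with an even number of edges. If $\frac{|E|}{2}$ is odd, then $G$ is not balanceable.
   Context: All graphs are simple and finite. A graph is eulerian if all its vertices have even degree (connectedness is not required). A 2-coloring of the edges of $K_n$ is a function $\alpha:E(K_n)\to\{R,B\}$. It contains a balanced copy of a graph $G$ if $K_n$ has a (not necessarily induced) subgraph isomorphic to $G$ whose edge set is partitioned into $E_1,E_2$ with $\alpha(e)=R$ for $e\in E_1$, $\alpha(e)=B$ for $e\in E_2$, and $\big||E_1|-|E_2|\big|\le 1$. A graph $G$ is balanceable if there is an $n_0$ such that for every $n\ge n_0$ there exists an integer $m$ with $0\le m<\lfloor \frac12\binom n2\rfloor$ such that every 2-coloring $\alpha$ of $E(K_n)$ with $|\alpha^{ -1}(R)|>m$ and $|\alpha^{ -1}(B)|>m$ contains a balanced copy of $G$. -}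

module Defs where

open import Data.Bool.Base using (Bool; T; _∧_; _∨_)
open import Data.Bool.Properties using (T?)
open import Data.Fin.Base using (Fin; zero; suc; _<_)
open import Data.Fin.Properties using (_≟_)
open import Data.Fin.Subset as Subset using (Subset)
open import Data.List.Base using (List; []; _++_; map; allFin; filter; length)
open import Data.Nat.Base as ℕ using (ℕ; zero; suc; z<s; s<s; ∣_-_∣)
open import Data.Nat.Combinatorics using (_C_)
open import Data.Nat.Divisibility using (_∣_)
open import Data.Nat.DivMod using (_/_)
open import Data.Product.Base using (Σ; ∃; _×_; proj₁)
open import Data.Sum.Base using (_⊎_)
open import Function.Bundles using (_⤖_; _⇔_; module Bijection)
open import Relation.Binary.PropositionalEquality using (_≡_; refl)
open import Relation.Nullary using (¬_; does; yes; no)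
open import Relation.Binary.Definitions using (DecidableEquality)

-- The unordered pair {lo, hi} of distinct vertices, stored in increasing
-- order so that each pair has exactly one representation.
record Edge (n : ℕ) : Set where
  constructor edge
  field
    lo hi  : Fin n
    .lo<hi : lo < hi

open Edge public

sucᵉ : ∀ {n} → Edge n → Edge (suc n)
sucᵉ (edge i j i<j) = edge (suc i) (suc j) (s<s i<j)

-- Every edge of Kₙ exactly once: those at vertex zero, then the others.
allEdges : ∀ n → List (Edge n)
allEdges zero    = []
allEdges (suc n) =
  map (λ j → edge zero (suc j) z<s) (allFin n) ++ map sucᵉ (allEdges n)

EdgeSet : ℕ → Set
EdgeSet n = Edge n → Bool

infix 4 _∈ᵉ_

_∈ᵉ_ : ∀ {n} → Edge n → EdgeSet n → Set
e ∈ᵉ E = T (E e)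

card : ∀ {n} → EdgeSet n → ℕ
card {n} E = length (filter (λ e → T? (E e)) (allEdges n))

incident : ∀ {n} → Fin n → EdgeSet n
incident v e = does (v ≟ lo e) ∨ does (v ≟ hi e)

Adjacent : ∀ {n} → EdgeSet n → Fin n → Fin n → Set
Adjacent E u v =
  ∃ λ e → e ∈ᵉ E × ((lo e ≡ u × hi e ≡ v) ⊎ (lo e ≡ v × hi e ≡ u))

record Graph : Set where
  field
    order : ℕ
    edges : EdgeSet order

  size : ℕ
  size = card edges

  degree : Fin order → ℕ
  degree v = card (λ e → edges e ∧ incident v e)

Eulerian : Graph → Set
Eulerian G = ∀ v → 2 ∣ degree v
  where open Graph G

-- A (not necessarily induced, not necessarily spanning) subgraph of Kₙ.
record Subgraph (n : ℕ) : Set where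
  field
    vertices : Subset n
    edges    : EdgeSet n
    closed   : ∀ e → e ∈ᵉ edges →
               lo e Subset.∈ vertices × hi e Subset.∈ vertices

  Vertex : Set
  Vertex = Σ (Fin n) (Subset._∈ vertices)

record _≅_ {n} (G : Graph) (H : Subgraph n) : Set where
  field
    bijection : Fin (Graph.order G) ⤖ Subgraph.Vertex H

  vertexMap : Fin (Graph.order G) → Fin n
  vertexMap v = proj₁ (Bijection.to bijection v)

  field
    adjacency : ∀ u v → Adjacent (Graph.edges G) u v ⇔
                        Adjacent (Subgraph.edges H) (vertexMap u) (vertexMap v)

data Colour : Set where
  R B : Colour

_≟ᶜ_ : DecidableEquality Colour
R ≟ᶜ R = yes refl
R ≟ᶜ B = no λ ()
B ≟ᶜ R = no λ ()
B ≟ᶜ B = yes refl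

Colouring : ℕ → Set
Colouring n = Edge n → Colour

_⁻¹[_] : ∀ {n} → Colouring n → Colour → EdgeSet n
(α ⁻¹[ c ]) e = does (α e ≟ᶜ c)

record BalancedCopy {n} (G : Graph) (α : Colouring n) : Set where
  field
    subgraph : Subgraph n
    iso      : G ≅ subgraph
    E₁ E₂    : EdgeSet n
    cover    : ∀ e → e ∈ᵉ Subgraph.edges subgraph ⇔ (e ∈ᵉ E₁ ⊎ e ∈ᵉ E₂)
    disjoint : ∀ e → ¬ (e ∈ᵉ E₁ × e ∈ᵉ E₂)
    red      : ∀ e → e ∈ᵉ E₁ → α e ≡ R
    blue     : ∀ e → e ∈ᵉ E₂ → α e ≡ B
    balanced : ∣ card E₁ - card E₂ ∣ ℕ.≤ 1

Balanceable : Graph → Set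
Balanceable G =
  ∃ λ n₀ → ∀ n → n₀ ℕ.≤ n →
    ∃ λ m → m ℕ.< (n C 2) / 2 ×
      (∀ (α : Colouring n) →
        m ℕ.< card (α ⁻¹[ R ]) → m ℕ.< card (α ⁻¹[ B ]) →
        BalancedCopy G α)

{-# OPTIONS --safe #-}
-- Colour an edge red when it crosses a fixed cut of Kₙ.  An eulerian graph meets
-- every cut in an even number of edges, so no copy of G has exactly size G / 2
-- red edges when this number is odd.  For n = s², cutting the vertices into
-- parts of C(s,2) and C(s+1,2) vertices makes exactly half of all edges red, so
-- every admissible m is exceeded by both colour classes.
module Submission where

open import Defs
open import Data.Nat.Base using (nonZero)
open import Data.Nat.Divisibility using (_∣_)
open import Data.Nat.DivMod using (_/_)
open import Relation.Nullary using (¬_)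

open import Data.Bool.Base
  using (Bool; true; false; T; not; _∧_; _xor_; if_then_else_)
open import Data.Bool.Properties using (T?; T-∧; xor-comm)
open import Data.Empty.Irrelevant using (⊥-elim)
open import Data.Fin.Base using (Fin; zero; suc)
open import Data.Fin.Properties using (_≟_; <-cmp)
open import Data.List.Base
  using (List; []; _∷_; _++_; map; allFin; filter; length)
open import Data.List.Membership.Propositional using (_∈_)
open import Data.List.Membership.Propositional.Properties
open import Data.List.Membership.Propositional.Properties.WithK
  using (unique∧set⇒bag)
open import Data.List.Properties
  using (map-∘; map-++; map-tabulate; map-cong; length-map; length-++; length-tabulate)
open import Data.List.Relation.Binary.BagAndSetEquality using (∼bag⇒↭)
open import Data.List.Relation.Binary.Permutation.Propositional.Properties
  using (↭-length)
open import Data.List.Relation.Unary.Unique.Propositional using (Unique; [])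
import Data.List.Relation.Unary.Unique.Propositional.Properties as Unique
open import Data.Nat.Base as ℕ
  using (ℕ; zero; suc; _+_; _*_; ∣_-_∣; z<s; s<s⁻¹; s≤s)
open import Data.Nat.Combinatorics using (_C_; nC1≡n; nCk+nC[k+1]≡[n+1]C[k+1])
open import Data.Nat.DivMod using (m*n/n≡m)
open import Data.Nat.Divisibility
  using (divides-refl; ∣m∣n⇒∣m+n; ∣m+n∣m⇒∣n; ∣n⇒∣m*n; m∣m*n; _∣0)
open import Data.Nat.ListAction using (sum)
open import Data.Nat.ListAction.Properties using (sum-++)
import Data.Nat.Properties as ℕ
open import Data.Nat.Tactic.RingSolver using (solve-∀)
open import Data.Product.Base using (∃; _×_; _,_; proj₁; proj₂)
open import Data.Sum.Base using (_⊎_; inj₁; inj₂)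
open import Data.Vec.Properties.WithK using ([]=-irrelevant)
open import Function.Base using (_∘_; id)
open import Function.Bundles using (mk⇔; module Equivalence; module Bijection)
open import Relation.Binary.Definitions using (tri<; tri≈; tri>)
open import Relation.Binary.PropositionalEquality
open import Relation.Nullary using (does; yes; no; contradiction)

open ≡-Reasoning

-- Finite sums over lists.

𝟙 : Bool → ℕ
𝟙 true  = 1
𝟙 false = 0

∑ : {A : Set} → List A → (A → ℕ) → ℕ
∑ xs f = sum (map f xs)

module _ {A : Set} where

  ∑-cong : (xs : List A) {f g : A → ℕ} → f ≗ g → ∑ xs f ≡ ∑ xs g
  ∑-cong xs f≗g = cong sum (map-cong f≗g xs)

  ∑-zero : (xs : List A) → ∑ xs (λ _ → 0) ≡ 0
  ∑-zero []       = refl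
  ∑-zero (x ∷ xs) = ∑-zero xs

  ∑-one : (xs : List A) → ∑ xs (λ _ → 1) ≡ length xs
  ∑-one []       = refl
  ∑-one (x ∷ xs) = cong suc (∑-one xs)

  ∑-+ : (xs : List A) (f g : A → ℕ) → ∑ xs (λ x → f x + g x) ≡ ∑ xs f + ∑ xs g
  ∑-+ []       f g = refl
  ∑-+ (x ∷ xs) f g rewrite ∑-+ xs f g = interchange (f x) (g x) (∑ xs f) (∑ xs g)
    where
    interchange : ∀ a b c d → (a + b) + (c + d) ≡ (a + c) + (b + d)
    interchange = solve-∀

  ∑-*ˡ : (xs : List A) (k : ℕ) (f : A → ℕ) → ∑ xs (λ x → k * f x) ≡ k * ∑ xs f
  ∑-*ˡ []       k f = sym (ℕ.*-zeroʳ k)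
  ∑-*ˡ (x ∷ xs) k f =
    trans (cong (k * f x +_) (∑-*ˡ xs k f)) (sym (ℕ.*-distribˡ-+ k (f x) (∑ xs f)))

  ∑-++ : (xs ys : List A) (f : A → ℕ) → ∑ (xs ++ ys) f ≡ ∑ xs f + ∑ ys f
  ∑-++ xs ys f = trans (cong sum (map-++ f xs ys)) (sum-++ (map f xs) (map f ys))

  ∑-even : (xs : List A) {f : A → ℕ} → (∀ x → 2 ∣ f x) → 2 ∣ ∑ xs f
  ∑-even []       2∣f = 2 ∣0
  ∑-even (x ∷ xs) 2∣f = ∣m∣n⇒∣m+n (2∣f x) (∑-even xs 2∣f)

  length-filter≡∑ : (E : A → Bool) (xs : List A) →
                    length (filter (λ x → T? (E x)) xs) ≡ ∑ xs (𝟙 ∘ E)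
  length-filter≡∑ E []       = refl
  length-filter≡∑ E (x ∷ xs) with E x
  ... | true  = cong suc (length-filter≡∑ E xs)
  ... | false = length-filter≡∑ E xs

∑-map : {A B : Set} (g : A → B) (xs : List A) (f : B → ℕ) → ∑ (map g xs) f ≡ ∑ xs (f ∘ g)
∑-map g xs f = cong sum (sym (map-∘ xs))

∑-swap : {A B : Set} (xs : List A) (ys : List B) (f : A → B → ℕ) →
         ∑ xs (λ x → ∑ ys (f x)) ≡ ∑ ys (λ y → ∑ xs (λ x → f x y))
∑-swap []       ys f = sym (∑-zero ys)
∑-swap (x ∷ xs) ys f = begin
  ∑ ys (f x) + ∑ xs (λ x → ∑ ys (f x))            ≡⟨ cong (∑ ys (f x) +_) (∑-swap xs ys f) ⟩
  ∑ ys (f x) + ∑ ys (λ y → ∑ xs (λ x → f x y))    ≡⟨ ∑-+ ys (f x) _ ⟨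
  ∑ ys (λ y → f x y + ∑ xs (λ x → f x y))         ∎

∑-allFin-suc : ∀ {n} (f : Fin (suc n) → ℕ) →
               ∑ (allFin (suc n)) f ≡ f zero + ∑ (allFin n) (f ∘ suc)
∑-allFin-suc f =
  cong (λ xs → f zero + sum xs)
       (trans (map-tabulate suc f) (sym (map-tabulate id (f ∘ suc))))

-- Collapses a sum over all vertices to the contribution of one endpoint when degrees are double
-- counted.
∑-δ : ∀ {n} (f : Fin n → ℕ) i → ∑ (allFin n) (λ v → f v * 𝟙 (does (v ≟ i))) ≡ f i
∑-δ {suc n} f zero = begin
  ∑ (allFin (suc n)) (λ v → f v * 𝟙 (does (v ≟ zero)))
    ≡⟨ ∑-allFin-suc (λ v → f v * 𝟙 (does (v ≟ zero))) ⟩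
  f zero * 1 + ∑ (allFin n) (λ v → f (suc v) * 0)
    ≡⟨ cong₂ _+_ (ℕ.*-identityʳ (f zero)) (∑-cong (allFin n) (λ v → ℕ.*-zeroʳ (f (suc v)))) ⟩
  f zero + ∑ (allFin n) (λ _ → 0)
    ≡⟨ cong (f zero +_) (∑-zero (allFin n)) ⟩
  f zero + 0
    ≡⟨ ℕ.+-identityʳ (f zero) ⟩
  f zero ∎
∑-δ {suc n} f (suc i) = begin
  ∑ (allFin (suc n)) (λ v → f v * 𝟙 (does (v ≟ suc i)))
    ≡⟨ ∑-allFin-suc (λ v → f v * 𝟙 (does (v ≟ suc i))) ⟩
  f zero * 0 + ∑ (allFin n) (λ v → f (suc v) * 𝟙 (does (v ≟ i)))
    ≡⟨ cong₂ _+_ (ℕ.*-zeroʳ (f zero)) (∑-δ (f ∘ suc) i) ⟩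
  f (suc i) ∎

-- Counting edges.

card≡∑ : ∀ {n} (E : EdgeSet n) → card E ≡ ∑ (allEdges n) (𝟙 ∘ E)
card≡∑ {n} E = length-filter≡∑ E (allEdges n)

card-cong : ∀ {n} {E F : EdgeSet n} → E ≗ F → card E ≡ card F
card-cong {n} {E} {F} E≗F = begin
  card E                  ≡⟨ card≡∑ E ⟩
  ∑ (allEdges n) (𝟙 ∘ E)  ≡⟨ ∑-cong (allEdges n) (cong 𝟙 ∘ E≗F) ⟩
  ∑ (allEdges n) (𝟙 ∘ F)  ≡⟨ card≡∑ F ⟨
  card F                  ∎

card-split : ∀ {n} (E P : EdgeSet n) →
             card (λ e → E e ∧ P e) + card (λ e → E e ∧ not (P e)) ≡ card E
card-split {n} E P = begin
  card (λ e → E e ∧ P e) + card (λ e → E e ∧ not (P e))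
    ≡⟨ cong₂ _+_ (card≡∑ (λ e → E e ∧ P e)) (card≡∑ (λ e → E e ∧ not (P e))) ⟩
  ∑ (allEdges n) (λ e → 𝟙 (E e ∧ P e)) + ∑ (allEdges n) (λ e → 𝟙 (E e ∧ not (P e)))
    ≡⟨ ∑-+ (allEdges n) _ _ ⟨
  ∑ (allEdges n) (λ e → 𝟙 (E e ∧ P e) + 𝟙 (E e ∧ not (P e)))
    ≡⟨ ∑-cong (allEdges n) (λ e → split (E e) (P e)) ⟩
  ∑ (allEdges n) (𝟙 ∘ E)
    ≡⟨ card≡∑ E ⟨
  card E ∎
  where
  split : ∀ x y → 𝟙 (x ∧ y) + 𝟙 (x ∧ not y) ≡ 𝟙 x
  split true  true  = refl
  split true  false = refl
  split false y     = refl

∑-allEdges-suc : ∀ {n} (f : Edge (suc n) → ℕ) →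
                 ∑ (allEdges (suc n)) f ≡
                 ∑ (allFin n) (λ j → f (edge zero (suc j) z<s)) + ∑ (allEdges n) (f ∘ sucᵉ)
∑-allEdges-suc {n} f =
  trans (∑-++ (map (λ j → edge zero (suc j) z<s) (allFin n)) (map sucᵉ (allEdges n)) f)
        (cong₂ _+_ (∑-map _ (allFin n) f) (∑-map sucᵉ (allEdges n) f))

length-allEdges : ∀ n → length (allEdges n) ≡ n C 2
length-allEdges zero    = refl
length-allEdges (suc n) = begin
  length (map (λ j → edge zero (suc j) z<s) (allFin n) ++ map sucᵉ (allEdges n))
    ≡⟨ length-++ (map (λ j → edge zero (suc j) z<s) (allFin n)) ⟩
  length (map (λ j → edge zero (suc j) z<s) (allFin n)) + length (map sucᵉ (allEdges n))
    ≡⟨ cong₂ _+_ (trans (length-map _ (allFin n)) (length-tabulate id))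
                 (trans (length-map sucᵉ (allEdges n)) (length-allEdges n)) ⟩
  n + (n C 2)
    ≡⟨ cong (_+ (n C 2)) (nC1≡n n) ⟨
  (n C 1) + (n C 2)
    ≡⟨ nCk+nC[k+1]≡[n+1]C[k+1] n 1 ⟩
  suc n C 2 ∎

∈-allEdges : ∀ {n} (e : Edge n) → e ∈ allEdges n
∈-allEdges {suc n} (edge zero    zero    ())
-- The order proof is an irrelevant field, so this edge equals the listed one whatever proof it
-- carries.
∈-allEdges {suc n} (edge zero    (suc j) _) =
  ∈-++⁺ˡ (∈-map⁺ (λ j → edge zero (suc j) z<s) (∈-allFin j))
∈-allEdges {suc n} (edge (suc i) zero    ())
∈-allEdges {suc n} (edge (suc i) (suc j) i<j) =
  ∈-++⁺ʳ (map (λ j → edge zero (suc j) z<s) (allFin n))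
    (∈-map⁺ sucᵉ (∈-allEdges (edge i j (s<s⁻¹ i<j))))

allEdges-unique : ∀ n → Unique (allEdges n)
allEdges-unique zero    = []
allEdges-unique (suc n) = Unique.++⁺
  (Unique.map⁺ (λ { refl → refl }) (Unique.allFin⁺ n))
  (Unique.map⁺ (λ { {edge _ _ _} {edge _ _ _} refl → refl }) (allEdges-unique n))
  disjoint
  where
  disjoint : ∀ {e} → ¬ (e ∈ map (λ j → edge zero (suc j) z<s) (allFin n) × e ∈ map sucᵉ (allEdges n))
  disjoint (p , q) with ∈-map⁻ _ p | ∈-map⁻ _ q
  ... | _ , _ , refl | _ , _ , ()

-- Injectivity keeps the image of the list of `E` free of duplicates. Two duplicate-free lists with
-- the same members are permutations of each other, hence equally long.
card-image : ∀ {m n} (f : Edge m → Edge n) → (∀ {e e′} → f e ≡ f e′ → e ≡ e′) →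
             {E : EdgeSet m} {F : EdgeSet n} →
             (∀ e → e ∈ᵉ E → f e ∈ᵉ F) →
             (∀ e → e ∈ᵉ F → ∃ λ e′ → e′ ∈ᵉ E × e ≡ f e′) →
             card E ≡ card F
card-image {m} {n} f f-inj {E} {F} f-into f-onto =
  trans (sym (length-map f (filter E? (allEdges m))))
    (↭-length (∼bag⇒↭ (unique∧set⇒bag
      (Unique.map⁺ f-inj (Unique.filter⁺ E? (allEdges-unique m)))
      (Unique.filter⁺ F? (allEdges-unique n))
      (mk⇔ to from))))
  where
  E? = λ e → T? (E e)
  F? = λ e → T? (F e)
  to : ∀ {e} → e ∈ map f (filter E? (allEdges m)) → e ∈ filter F? (allEdges n)
  to p with ∈-map⁻ f p
  ... | e , q , refl =
    ∈-filter⁺ F? (∈-allEdges (f e)) (f-into e (proj₂ (∈-filter⁻ E? {xs = allEdges m} q)))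
  from : ∀ {e} → e ∈ filter F? (allEdges n) → e ∈ map f (filter E? (allEdges m))
  from {e} p with f-onto e (proj₂ (∈-filter⁻ F? {xs = allEdges n} p))
  ... | e′ , e′∈E , refl = ∈-map⁺ f (∈-filter⁺ E? (∈-allEdges e′) e′∈E)

-- Edges as unordered pairs, and cuts.

lo≢hi : ∀ {n} (e : Edge n) → lo e ≢ hi e
lo≢hi (edge i .i i<i) refl = ⊥-elim (ℕ.<-irrefl refl i<i)

-- Orientation is forgotten because a graph isomorphism need not respect the order on `Fin` by which
-- edges are stored.
Joins : ∀ {n} → Edge n → Fin n → Fin n → Set
Joins e u v = (lo e ≡ u × hi e ≡ v) ⊎ (lo e ≡ v × hi e ≡ u)

-- With equal orientations the edges agree up to an irrelevant proof; opposite orientations would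
-- give both `i < j` and `j < i`.
Joins-unique : ∀ {n} {e e′ : Edge n} {u v} → Joins e u v → Joins e′ u v → e ≡ e′
Joins-unique (inj₁ (refl , refl)) (inj₁ (refl , refl)) = refl
Joins-unique (inj₂ (refl , refl)) (inj₂ (refl , refl)) = refl
Joins-unique {e = edge i j i<j} {edge .j .i j<i} (inj₁ (refl , refl)) (inj₂ (refl , refl)) =
  ⊥-elim (ℕ.<-asym i<j j<i)
Joins-unique {e = edge i j i<j} {edge .j .i j<i} (inj₂ (refl , refl)) (inj₁ (refl , refl)) =
  ⊥-elim (ℕ.<-asym i<j j<i)

join : ∀ {n} (u v : Fin n) → u ≢ v → ∃ λ e → Joins e u v
join u v u≢v with <-cmp u v
... | tri< u<v _ _ = edge u v u<v , inj₁ (refl , refl)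
... | tri≈ _ u≡v _ = contradiction u≡v u≢v
... | tri> _ _ v<u = edge v u v<u , inj₂ (refl , refl)

crossing : ∀ {n} → (Fin n → Bool) → EdgeSet n
crossing s e = s (lo e) xor s (hi e)

crossing-Joins : ∀ {n} (s : Fin n → Bool) {e u v} → Joins e u v → crossing s e ≡ s u xor s v
crossing-Joins s (inj₁ (refl , refl)) = refl
crossing-Joins s {e} (inj₂ (refl , refl)) = xor-comm (s (lo e)) (s (hi e))

-- The two ends of an edge differ, so at most one disjunct of `incident` holds and the disjunction
-- becomes a sum.
𝟙-incident : ∀ {n} (v : Fin n) e →
             𝟙 (incident v e) ≡ 𝟙 (does (v ≟ lo e)) + 𝟙 (does (v ≟ hi e))
𝟙-incident v e with v ≟ lo e | v ≟ hi e
... | yes v≡lo | yes v≡hi = contradiction (trans (sym v≡lo) v≡hi) (lo≢hi e)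
... | yes _    | no _     = refl
... | no _     | yes _    = refl
... | no _     | no _     = refl

-- Summing degrees over one side of the cut counts crossing edges once and edges
-- inside that side twice.
cut-even : ∀ {n} (E : EdgeSet n) → (∀ v → 2 ∣ card (λ e → E e ∧ incident v e)) →
           ∀ s → 2 ∣ card (λ e → E e ∧ crossing s e)
cut-even {n} E even s =
  -- The degree sum is even term by term, and so is `2 * inside`; the crossing edges are what
  -- remains.
  ∣m+n∣m⇒∣n (subst (2 ∣_) degree-sum (∑-even (allFin n) (λ v → ∣n⇒∣m*n (𝟙 (s v)) (even v))))
            (m∣m*n inside)
  where
  inside : ℕ
  inside = card (λ e → E e ∧ (s (lo e) ∧ s (hi e)))

  𝟙-∧ : ∀ x y → 𝟙 (x ∧ y) ≡ 𝟙 x * 𝟙 y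
  𝟙-∧ true  y = sym (ℕ.+-identityʳ (𝟙 y))
  𝟙-∧ false y = refl

  rearrange : ∀ a b c d → a * (b * (c + d)) ≡ b * (a * c + a * d)
  rearrange = solve-∀

  summand : ∀ e v → 𝟙 (s v) * 𝟙 (E e ∧ incident v e) ≡
                    𝟙 (E e) * (𝟙 (s v) * 𝟙 (does (v ≟ lo e)) + 𝟙 (s v) * 𝟙 (does (v ≟ hi e)))
  summand e v rewrite 𝟙-∧ (E e) (incident v e) | 𝟙-incident v e =
    rearrange (𝟙 (s v)) (𝟙 (E e)) (𝟙 (does (v ≟ lo e))) (𝟙 (does (v ≟ hi e)))

  -- Addition of two bits: `y ∧ z` is the carry and `y xor z` the low digit.
  split : ∀ x y z → 𝟙 x * (𝟙 y + 𝟙 z) ≡ 2 * 𝟙 (x ∧ (y ∧ z)) + 𝟙 (x ∧ (y xor z))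
  split true  true  true  = refl
  split true  true  false = refl
  split true  false true  = refl
  split true  false false = refl
  split false y     z     = refl

  edge-sum : ∀ e → ∑ (allFin n) (λ v → 𝟙 (s v) * 𝟙 (E e ∧ incident v e)) ≡
                   2 * 𝟙 (E e ∧ (s (lo e) ∧ s (hi e))) + 𝟙 (E e ∧ crossing s e)
  edge-sum e = begin
    ∑ (allFin n) (λ v → 𝟙 (s v) * 𝟙 (E e ∧ incident v e))
      ≡⟨ ∑-cong (allFin n) (summand e) ⟩
    ∑ (allFin n) (λ v → 𝟙 (E e) * (𝟙 (s v) * 𝟙 (does (v ≟ lo e)) + 𝟙 (s v) * 𝟙 (does (v ≟ hi e))))
      ≡⟨ ∑-*ˡ (allFin n) (𝟙 (E e)) _ ⟩
    𝟙 (E e) * ∑ (allFin n) (λ v → 𝟙 (s v) * 𝟙 (does (v ≟ lo e)) + 𝟙 (s v) * 𝟙 (does (v ≟ hi e)))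
      ≡⟨ cong (𝟙 (E e) *_) (∑-+ (allFin n) _ _) ⟩
    𝟙 (E e) * (∑ (allFin n) (λ v → 𝟙 (s v) * 𝟙 (does (v ≟ lo e))) +
               ∑ (allFin n) (λ v → 𝟙 (s v) * 𝟙 (does (v ≟ hi e))))
      ≡⟨ cong (𝟙 (E e) *_) (cong₂ _+_ (∑-δ (𝟙 ∘ s) (lo e)) (∑-δ (𝟙 ∘ s) (hi e))) ⟩
    𝟙 (E e) * (𝟙 (s (lo e)) + 𝟙 (s (hi e)))
      ≡⟨ split (E e) (s (lo e)) (s (hi e)) ⟩
    2 * 𝟙 (E e ∧ (s (lo e) ∧ s (hi e))) + 𝟙 (E e ∧ crossing s e) ∎

  degree-sum : ∑ (allFin n) (λ v → 𝟙 (s v) * card (λ e → E e ∧ incident v e)) ≡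
               2 * inside + card (λ e → E e ∧ crossing s e)
  degree-sum = begin
    ∑ (allFin n) (λ v → 𝟙 (s v) * card (λ e → E e ∧ incident v e))
      ≡⟨ ∑-cong (allFin n) (λ v → trans (cong (𝟙 (s v) *_) (card≡∑ (λ e → E e ∧ incident v e)))
                                        (sym (∑-*ˡ (allEdges n) (𝟙 (s v)) _))) ⟩
    ∑ (allFin n) (λ v → ∑ (allEdges n) (λ e → 𝟙 (s v) * 𝟙 (E e ∧ incident v e)))
      ≡⟨ ∑-swap (allFin n) (allEdges n) _ ⟩
    ∑ (allEdges n) (λ e → ∑ (allFin n) (λ v → 𝟙 (s v) * 𝟙 (E e ∧ incident v e)))
      ≡⟨ ∑-cong (allEdges n) edge-sum ⟩
    ∑ (allEdges n) (λ e → 2 * 𝟙 (E e ∧ (s (lo e) ∧ s (hi e))) + 𝟙 (E e ∧ crossing s e))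
      ≡⟨ ∑-+ (allEdges n) _ _ ⟩
    ∑ (allEdges n) (λ e → 2 * 𝟙 (E e ∧ (s (lo e) ∧ s (hi e)))) +
    ∑ (allEdges n) (λ e → 𝟙 (E e ∧ crossing s e))
      ≡⟨ cong₂ _+_ (trans (∑-*ˡ (allEdges n) 2 _) (cong (2 *_) (sym (card≡∑ (λ e → E e ∧ (s (lo e) ∧ s (hi e)))))))
                   (sym (card≡∑ (λ e → E e ∧ crossing s e))) ⟩
    2 * inside + card (λ e → E e ∧ crossing s e) ∎

-- Transport of edges and cuts along an isomorphism.

module _ {n} {G : Graph} {H : Subgraph n} (G≅H : G ≅ H) where
  open _≅_ G≅H
  private
    module G = Graph G
    module H = Subgraph H

  vertexMap-injective : ∀ {u v} → vertexMap u ≡ vertexMap v → u ≡ v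
  vertexMap-injective {u} {v} eq = Bijection.injective bijection (Σ-≡ _ _ eq)
    where
    -- A vertex of `H` carries a membership proof; such proofs are unique, so the underlying element
    -- of `Fin n` determines it.
    Σ-≡ : (x y : H.Vertex) → proj₁ x ≡ proj₁ y → x ≡ y
    Σ-≡ (x , p) (.x , q) refl = cong (x ,_) ([]=-irrelevant p q)

  vertexMap-onto : ∀ (x : H.Vertex) → ∃ λ u → vertexMap u ≡ proj₁ x
  vertexMap-onto x with Bijection.strictlySurjective bijection x
  ... | u , eq = u , cong proj₁ eq

  edgeMap-joins : ∀ e → ∃ λ e′ → Joins e′ (vertexMap (lo e)) (vertexMap (hi e))
  edgeMap-joins e = join _ _ (lo≢hi e ∘ vertexMap-injective)

  edgeMap : Edge G.order → Edge n
  edgeMap = proj₁ ∘ edgeMap-joins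

  -- A common image edge gives two descriptions of one unordered pair. Injectivity on vertices pulls
  -- this back, possibly with the ends swapped, which `Joins` tolerates.
  edgeMap-injective : ∀ {e e′} → edgeMap e ≡ edgeMap e′ → e ≡ e′
  edgeMap-injective {e} {e′} eq =
    Joins-unique (pullback {edgeMap e} (edgeMap-joins e .proj₂)
                   (subst (λ d → Joins d _ _) (sym eq) (edgeMap-joins e′ .proj₂)))
                 (inj₁ (refl , refl))
    where
    pullback : ∀ {d : Edge n} {u v u′ v′} →
               Joins d (vertexMap u) (vertexMap v) → Joins d (vertexMap u′) (vertexMap v′) →
               (u ≡ u′ × v ≡ v′) ⊎ (u ≡ v′ × v ≡ u′)
    pullback (inj₁ (p , q)) (inj₁ (p′ , q′)) =
      inj₁ (vertexMap-injective (trans (sym p) p′) , vertexMap-injective (trans (sym q) q′))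
    pullback (inj₁ (p , q)) (inj₂ (p′ , q′)) =
      inj₂ (vertexMap-injective (trans (sym p) p′) , vertexMap-injective (trans (sym q) q′))
    pullback (inj₂ (p , q)) (inj₁ (p′ , q′)) =
      inj₂ (vertexMap-injective (trans (sym q) q′) , vertexMap-injective (trans (sym p) p′))
    pullback (inj₂ (p , q)) (inj₂ (p′ , q′)) =
      inj₁ (vertexMap-injective (trans (sym q) q′) , vertexMap-injective (trans (sym p) p′))

  -- `adjacency` supplies only some edge of `H` between the image vertices; uniqueness identifies it
  -- with `edgeMap e`.
  edgeMap-into : ∀ e → e ∈ᵉ G.edges → edgeMap e ∈ᵉ H.edges
  edgeMap-into e e∈G
    with e′ , e′∈H , joins ← Equivalence.to (adjacency (lo e) (hi e)) (e , e∈G , inj₁ (refl , refl)) =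
    subst (_∈ᵉ H.edges) (Joins-unique joins (edgeMap-joins e .proj₂)) e′∈H

  edgeMap-onto : ∀ e → e ∈ᵉ H.edges → ∃ λ e′ → e′ ∈ᵉ G.edges × e ≡ edgeMap e′
  edgeMap-onto e e∈H
    -- `closed` places both ends of `e` among the vertices of `H`, the only ones that are known to
    -- have preimages.
    with u , u↦lo ← vertexMap-onto (lo e , proj₁ (H.closed e e∈H))
       | v , v↦hi ← vertexMap-onto (hi e , proj₂ (H.closed e e∈H))
    with Equivalence.from (adjacency u v) (e , e∈H , inj₁ (sym u↦lo , sym v↦hi))
  ... | e′ , e′∈G , inj₁ (refl , refl) =
    e′ , e′∈G , Joins-unique (inj₁ (sym u↦lo , sym v↦hi)) (edgeMap-joins e′ .proj₂)
  ... | e′ , e′∈G , inj₂ (refl , refl) =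
    e′ , e′∈G , Joins-unique (inj₂ (sym u↦lo , sym v↦hi)) (edgeMap-joins e′ .proj₂)

  size-≅ : card G.edges ≡ card H.edges
  size-≅ = card-image edgeMap edgeMap-injective {G.edges} {H.edges} edgeMap-into edgeMap-onto

  -- A cut of the host pulls back along `vertexMap` to a cut of `G`, and `edgeMap` preserves and
  -- reflects crossing. This lets the parity of cuts in `G` be read off in the copy.
  crossing-≅ : ∀ s → card (λ e → G.edges e ∧ crossing (s ∘ vertexMap) e) ≡
                     card (λ e → H.edges e ∧ crossing s e)
  crossing-≅ s = card-image edgeMap edgeMap-injective into onto
    where
    same : ∀ e → crossing s (edgeMap e) ≡ crossing (s ∘ vertexMap) e
    same e = crossing-Joins s {edgeMap e} (edgeMap-joins e .proj₂)

    into : ∀ e → T (G.edges e ∧ crossing (s ∘ vertexMap) e) →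
           T (H.edges (edgeMap e) ∧ crossing s (edgeMap e))
    into e p with e∈G , c ← Equivalence.to T-∧ p =
      Equivalence.from T-∧ (edgeMap-into e e∈G , subst T (sym (same e)) c)

    onto : ∀ e → T (H.edges e ∧ crossing s e) →
           ∃ λ e′ → T (G.edges e′ ∧ crossing (s ∘ vertexMap) e′) × e ≡ edgeMap e′
    onto e p with e∈H , c ← Equivalence.to T-∧ p with edgeMap-onto e e∈H
    ... | e′ , e′∈G , refl = e′ , Equivalence.from T-∧ (e′∈G , subst T (same e′) c) , refl

-- Cut colourings contain no balanced copy.

cutColouring : ∀ {n} → (Fin n → Bool) → Colouring n
cutColouring s e = if crossing s e then R else B

T-cong : ∀ {x y} → (T x → T y) → (T y → T x) → x ≡ y
T-cong {true}  {true}  _ _ = refl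
T-cong {true}  {false} f _ = contradiction (f _) id
T-cong {false} {true}  _ g = contradiction (g _) id
T-cong {false} {false} _ _ = refl

-- The difference of two even numbers is even, so a difference of at most 1 is 0.
even-balanced : ∀ {a b} → 2 ∣ a → 2 ∣ b → ∣ a - b ∣ ℕ.≤ 1 → a ≡ b
even-balanced (divides-refl p) (divides-refl q) d≤1 =
  cong (_* 2) (ℕ.∣m-n∣≡0⇒m≡n {p} {q} (half ∣ p - q ∣ (subst (ℕ._≤ 1) (sym (ℕ.*-distribʳ-∣-∣ 2 p q)) d≤1)))
  where
  half : ∀ d → d * 2 ℕ.≤ 1 → d ≡ 0
  half zero    _         = refl
  half (suc d) (s≤s ())

-- The colours force `E₁` and `E₂` to be the crossing and non-crossing edges of the copy. The first
-- has even size by `cut-even`, the second because the total is even. Balance makes them equal, so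
-- half the size of `G` would be even.
cut-unbalanced : ∀ {n} (G : Graph) → Eulerian G → 2 ∣ Graph.size G → ¬ (2 ∣ Graph.size G / 2) →
                 (s : Fin n → Bool) → ¬ BalancedCopy G (cutColouring s)
cut-unbalanced {n} G eulerian 2∣size half-odd s copy =
  half-odd (subst (2 ∣_) (sym half≡E₁) 2∣E₁)
  where
  open BalancedCopy copy
  open Subgraph subgraph using () renaming (edges to H)

  colour-R : ∀ x → (if x then R else B) ≡ R → T x
  colour-R true _ = _

  colour-B : ∀ x → (if x then R else B) ≡ B → T (not x)
  colour-B false _ = _

  T-not : ∀ x → T x → ¬ T (not x)
  T-not true _ ()

  E₁≗ : ∀ e → E₁ e ≡ (H e ∧ crossing s e)
  E₁≗ e = T-cong
    (λ p → Equivalence.from T-∧ (Equivalence.from (cover e) (inj₁ p) , colour-R _ (red e p)))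
    from
    where
    from : T (H e ∧ crossing s e) → T (E₁ e)
    from p with e∈H , c ← Equivalence.to T-∧ p with Equivalence.to (cover e) e∈H
    ... | inj₁ q = q
    -- A crossing edge is red, so it cannot lie in the blue class.
    ... | inj₂ q = contradiction (colour-B _ (blue e q)) (T-not _ c)

  E₂≗ : ∀ e → E₂ e ≡ (H e ∧ not (crossing s e))
  E₂≗ e = T-cong
    (λ p → Equivalence.from T-∧ (Equivalence.from (cover e) (inj₂ p) , colour-B _ (blue e p)))
    from
    where
    from : T (H e ∧ not (crossing s e)) → T (E₂ e)
    from p with e∈H , c ← Equivalence.to T-∧ p with Equivalence.to (cover e) e∈H
    ... | inj₁ q = contradiction c (T-not _ (colour-R _ (red e q)))
    ... | inj₂ q = q

  size≡ : card E₁ + card E₂ ≡ Graph.size G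
  size≡ = begin
    card E₁ + card E₂
      ≡⟨ cong₂ _+_ (card-cong E₁≗) (card-cong E₂≗) ⟩
    card (λ e → H e ∧ crossing s e) + card (λ e → H e ∧ not (crossing s e))
      ≡⟨ card-split H (crossing s) ⟩
    card H
      ≡⟨ size-≅ iso ⟨
    Graph.size G ∎

  2∣E₁ : 2 ∣ card E₁
  2∣E₁ = subst (2 ∣_) (trans (crossing-≅ iso s) (sym (card-cong E₁≗)))
               (cut-even (Graph.edges G) eulerian (s ∘ _≅_.vertexMap iso))

  2∣E₂ : 2 ∣ card E₂
  2∣E₂ = ∣m+n∣m⇒∣n (subst (2 ∣_) (sym size≡) 2∣size) 2∣E₁

  half≡E₁ : Graph.size G / 2 ≡ card E₁
  half≡E₁ = begin
    Graph.size G / 2          ≡⟨ cong (_/ 2) size≡ ⟨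
    (card E₁ + card E₂) / 2   ≡⟨ cong (λ k → (card E₁ + k) / 2) (even-balanced 2∣E₁ 2∣E₂ balanced) ⟨
    (card E₁ + card E₁) / 2   ≡⟨ cong (_/ 2) (double (card E₁)) ⟩
    card E₁ * 2 / 2           ≡⟨ m*n/n≡m (card E₁) 2 ⟩
    card E₁                   ∎
    where
    double : ∀ k → k + k ≡ k * 2
    double = solve-∀

-- The number of edges across a cut of the complete graph.

count : ∀ {n} → (Fin n → Bool) → ℕ
count {n} s = ∑ (allFin n) (𝟙 ∘ s)

-- Induction on vertices: the crossing edges at vertex zero correspond to the later vertices on the
-- other side. This is the amount by which the product grows when the side of vertex zero gains one
-- element.
card-crossing : ∀ {n} (s : Fin n → Bool) → card (crossing s) ≡ count s * count (not ∘ s)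
card-crossing s = trans (card≡∑ (crossing s)) (go s)
  where
  go : ∀ {n} (s : Fin n → Bool) → ∑ (allEdges n) (𝟙 ∘ crossing s) ≡ count s * count (not ∘ s)
  go {zero}  s = refl
  go {suc n} s
    rewrite ∑-allEdges-suc (𝟙 ∘ crossing s) | ∑-allFin-suc (𝟙 ∘ s) | ∑-allFin-suc (𝟙 ∘ not ∘ s)
          | go (s ∘ suc)
    with s zero
  ... | true  = refl
  ... | false = sym (ℕ.*-suc (count (s ∘ suc)) (count (not ∘ s ∘ suc)))

initial : ∀ a b → Fin (a + b) → Bool
initial zero    b _       = false
initial (suc a) b zero    = true
initial (suc a) b (suc i) = initial a b i

∑-allFin-one : ∀ n → ∑ (allFin n) (λ _ → 1) ≡ n
∑-allFin-one n = trans (∑-one (allFin n)) (length-tabulate id)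

count-initial : ∀ a b → count (initial a b) ≡ a
count-initial zero    b = ∑-zero (allFin b)
count-initial (suc a) b = trans (∑-allFin-suc (𝟙 ∘ initial (suc a) b)) (cong suc (count-initial a b))

count-¬initial : ∀ a b → count (not ∘ initial a b) ≡ b
count-¬initial zero    b = ∑-allFin-one b
count-¬initial (suc a) b =
  trans (∑-allFin-suc (𝟙 ∘ not ∘ initial (suc a) b)) (count-¬initial a b)

-- Arithmetic of the half cut.

-- The formula C(n,2) = n(n-1)/2 without subtraction or division: ordered pairs are either diagonal
-- or one of two orders of an unordered pair.
nC2*2+n≡n*n : ∀ n → (n C 2) * 2 + n ≡ n * n
nC2*2+n≡n*n zero    = refl
nC2*2+n≡n*n (suc n) = begin
  (suc n C 2) * 2 + suc n          ≡⟨ cong (λ k → k * 2 + suc n) (nCk+nC[k+1]≡[n+1]C[k+1] n 1) ⟨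
  ((n C 1) + (n C 2)) * 2 + suc n  ≡⟨ cong (λ k → (k + (n C 2)) * 2 + suc n) (nC1≡n n) ⟩
  (n + (n C 2)) * 2 + suc n        ≡⟨ regroup n (n C 2) ⟩
  ((n C 2) * 2 + n) + suc (n * 2)  ≡⟨ cong (_+ suc (n * 2)) (nC2*2+n≡n*n n) ⟩
  n * n + suc (n * 2)              ≡⟨ square n ⟩
  suc n * suc n                    ∎
  where
  regroup : ∀ n c → (n + c) * 2 + suc n ≡ (c * 2 + n) + suc (n * 2)
  regroup = solve-∀
  square : ∀ n → n * n + suc (n * 2) ≡ suc n * suc n
  square = solve-∀

-- Here a + s = C(s+1,2), so a + (a + s) = s².
half-cut : ∀ s → let a = s C 2 in (a + (a + s)) C 2 ≡ a * (a + s) * 2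
-- Doubling both sides and adding `n` turns the left side into `n * n`.
half-cut s = ℕ.*-cancelʳ-≡ _ _ 2 (ℕ.+-cancelʳ-≡ n _ _ (begin
  (n C 2) * 2 + n              ≡⟨ nC2*2+n≡n*n n ⟩
  n * n                        ≡⟨ expand a s ⟩
  a * (a + s) * 2 * 2 + s * s  ≡⟨ cong (a * (a + s) * 2 * 2 +_) n≡s² ⟨
  a * (a + s) * 2 * 2 + n      ∎))
  where
  a = s C 2
  n = a + (a + s)

  -- This is (a+b)² = 4ab + (b-a)² with b = a + s. By `n≡s²` the last square is `n` itself, which
  -- then cancels.
  expand : ∀ a s → (a + (a + s)) * (a + (a + s)) ≡ a * (a + s) * 2 * 2 + s * s
  expand = solve-∀

  regroup : ∀ a s → a + (a + s) ≡ a * 2 + s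
  regroup = solve-∀

  n≡s² : n ≡ s * s
  n≡s² = trans (regroup a s) (nC2*2+n≡n*n s)

-- Failure of balanceability at square orders.

proposition7 : (G : Graph) → Eulerian G → 2 ∣ Graph.size G → ¬ (2 ∣ Graph.size G / 2) → ¬ Balanceable G
proposition7 G eulerian 2∣size half-odd (n₀ , balanceable)
  -- The order chosen is n₀², written as the sum of the two part sizes so that `initial` applies
  -- directly; the summand `n₀` shows that it is at least `n₀`.
  with balanceable ((n₀ C 2) + ((n₀ C 2) + n₀))
         (ℕ.≤-trans (ℕ.m≤n+m n₀ (n₀ C 2)) (ℕ.m≤n+m _ (n₀ C 2)))
... | m , m<half , copy =
  cut-unbalanced G eulerian 2∣size half-odd side
    (copy (cutColouring side) (subst (m ℕ.<_) (sym red≡) m<ab) (subst (m ℕ.<_) (sym blue≡) m<ab))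
  where
  a = n₀ C 2
  b = a + n₀
  n = a + b
  side = initial a b

  -- By `half-cut` the number of all edges is exactly `a * b * 2`, so the floor in the bound on `m`
  -- loses nothing.
  m<ab : m ℕ.< a * b
  m<ab = subst (m ℕ.<_) (trans (cong (_/ 2) (half-cut n₀)) (m*n/n≡m (a * b) 2)) m<half

  is-R : ∀ x → does ((if x then R else B) ≟ᶜ R) ≡ x
  is-R true  = refl
  is-R false = refl

  is-B : ∀ x → does ((if x then R else B) ≟ᶜ B) ≡ not x
  is-B true  = refl
  is-B false = refl

  crossing≡ : card (crossing side) ≡ a * b
  crossing≡ = trans (card-crossing side) (cong₂ _*_ (count-initial a b) (count-¬initial a b))

  red≡ : card (cutColouring side ⁻¹[ R ]) ≡ a * b
  red≡ = trans (card-cong (λ e → is-R (crossing side e))) crossing≡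

  blue≡ : card (cutColouring side ⁻¹[ B ]) ≡ a * b
  -- The blue edges are the complement of the `a * b` crossing edges among `a * b * 2` edges in all.
  blue≡ = ℕ.+-cancelˡ-≡ (a * b) _ _ (begin
    a * b + card (cutColouring side ⁻¹[ B ])
      ≡⟨ cong₂ _+_ (sym crossing≡) (card-cong (λ e → is-B (crossing side e))) ⟩
    card (crossing side) + card (not ∘ crossing side)
      ≡⟨ card-split (λ _ → true) (crossing side) ⟩
    card {n} (λ _ → true)
      ≡⟨ trans (card≡∑ {n} (λ _ → true)) (∑-one (allEdges n)) ⟩
    length (allEdges n)
      ≡⟨ trans (length-allEdges n) (half-cut n₀) ⟩
    a * b * 2
      ≡⟨ double (a * b) ⟩
    a * b + a * b ∎)
    where
    double : ∀ k → k * 2 ≡ k + k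
    double = solve-∀
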